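{- For $15$ symbols, $9$ rows and $10$ columns: there is no transposed sesqui array, i.e. there is no $9\times 10$ row-column design on $15$ symbols (with replication number $6$) that satisfies both (CC) and (RC). There do, however, exist proper AO-arrays with these parameters, i.e. $9\times 10$ row-column designs on $15$ symbols satisfying (RC) but neither (RR) nor (CC).
   Context: A row-column design is an $r\times c$ array on $v$ symbols such that no symbol occurs more than once in any row or any column, and every symbol occurs exactly $e$ times in the array (so $ev=rc$). Identify rows and columns with their symbol sets. (RR): there is a constant $\lambda_{rr}$ such that any two distinct rows have exactly $\lambda_{rr}$ common symbols. (CC): there is a constant $\lambda_{cc}$ such that any two distinct columns have exactly $\lambda_{cc}$ common symbols. (RC): there is a constant $\lambda_{rc}$ such that any row and any column have exactly $\lambda_{rc}$ common symbols. -}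

module Defs where

open import Data.Nat.Base using (ℕ)
open import Data.Fin.Base using (Fin)
open import Data.Fin.Properties using (_≟_)
open import Data.Fin.Subset using (Subset; ⁅_⁆; ⋃; _∩_; ∣_∣)
open import Data.List.Base using (List; length; filter; allFin; tabulate; cartesianProduct)
open import Data.Product.Base using (_×_; _,_; ∃-syntax)
open import Function.Definitions using (Injective)
open import Relation.Binary.PropositionalEquality using (_≡_; _≢_)
open import Relation.Nullary.Negation using (¬_)

cells : ∀ r c → List (Fin r × Fin c)
cells r c = cartesianProduct (allFin r) (allFin c)

occurrences : ∀ {r c v} → (Fin r → Fin c → Fin v) → Fin v → ℕ
occurrences {r} {c} A s = length (filter (λ (i , j) → A i j ≟ s) (cells r c))

record RowColumnDesign (r c v e : ℕ) : Set where
  field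
    entry            : Fin r → Fin c → Fin v
    row-injective    : ∀ i → Injective _≡_ _≡_ (λ j → entry i j)
    column-injective : ∀ j → Injective _≡_ _≡_ (λ i → entry i j)
    equireplicate    : ∀ s → occurrences entry s ≡ e

  rowSet : Fin r → Subset v
  rowSet i = ⋃ (tabulate (λ j → ⁅ entry i j ⁆))

  columnSet : Fin c → Subset v
  columnSet j = ⋃ (tabulate (λ i → ⁅ entry i j ⁆))

module _ {r c v e : ℕ} (D : RowColumnDesign r c v e) where
  open RowColumnDesign D

  RR : Set
  RR = ∃[ λrr ] (∀ i i′ → i ≢ i′ → ∣ rowSet i ∩ rowSet i′ ∣ ≡ λrr)

  CC : Set
  CC = ∃[ λcc ] (∀ j j′ → j ≢ j′ → ∣ columnSet j ∩ columnSet j′ ∣ ≡ λcc)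

  RC : Set
  RC = ∃[ λrc ] (∀ i j → ∣ rowSet i ∩ columnSet j ∣ ≡ λrc)

  TransposedSesqui : Set
  TransposedSesqui = CC × RC

  ProperAO : Set
  ProperAO = RC × ¬ RR × ¬ CC

{-# OPTIONS --safe #-}

-- Write λ for the common size of two columns' intersection; counting gives λ = 5, and the
-- common size of a row and a column is 6.  Call two symbols adjacent when they are jointly
-- missing from exactly one column.  Any two distinct symbols are jointly missing from one
-- or two columns, and the adjacency matrix G satisfies G² = 4I + 4J.  The five symbols missing from
-- a row form a clique of G (in fact G is the triangular graph T(6) and the 5-cliques are its
-- six stars).  Two such cliques meet in 1 or 5 symbols, so the sum over all nine
-- rows of the sizes of the intersections with a fixed clique is 9 modulo 4.  But each symbol
-- is missing from three rows, so that sum is 15.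

module Submission where

open import Defs
open import Data.Product.Base using (_×_; Σ-syntax)
open import Relation.Nullary.Negation using (¬_)

open import Data.Bool.Base using (Bool; true; false; if_then_else_; _∨_)
open import Data.Empty using (⊥; ⊥-elim)
open import Data.Fin using (#_)
open import Data.Fin.Base using (Fin; zero; suc)
open import Data.Fin.Patterns using (0F; 1F; 3F; 7F)
open import Data.Fin.Properties using (_≟_; all?; any?; suc-injective)
open import Data.Fin.Subset using (Subset; ⁅_⁆; ⋃; _∩_; _∪_; ∣_∣)
open import Data.Integer.Base hiding (∣_∣; suc)
import Data.Integer.Base as ℤ
import Data.Integer.Properties as ℤ
open import Data.Integer.Properties hiding (_≟_)
open import Data.Integer.Tactic.RingSolver using (solve-∀)
open import Data.List.Base as List using (filter; length; cartesianProduct)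
open import Data.List.Properties using (filter-++; length-++; map-tabulate)
open import Data.Nat.Base as ℕ using (ℕ; zero; suc; z≤n; s≤s)
import Data.Nat.Divisibility as ℕ
import Data.Nat.Properties as ℕ
open import Data.Product.Base using (_,_; ∃-syntax; proj₁; proj₂)
open import Data.Sum.Base using (_⊎_; inj₁; inj₂)
open import Data.Vec.Base using (Vec; []; _∷_; lookup)
open import Data.Vec.Properties using (lookup-zipWith; lookup-replicate)
open import Function.Base using (id; _∘_)
open import Function.Definitions using (Injective)
open import Level using (0ℓ)
open import Relation.Binary.PropositionalEquality
open import Relation.Nullary.Decidable using (Dec; yes; no; does; from-yes; from-no; _→-dec_)
open import Relation.Unary using (Pred; Decidable)
open import Algebra.Properties.Semiring.Sum +-*-semiring
  using (sum; sum-syntax; sum-cong-≗; ∑-distrib-+; ∑-comm; *-distribˡ-sum; *-distribʳ-sum)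

private
  variable
    m n : ℕ

-- Finite sums of integers

-- Kronecker delta, by recursion on both indices rather than by a test with `≟`, so that `∑-δ*`
-- follows by induction.
δ : Fin n → Fin n → ℤ
δ zero    zero    = 1ℤ
δ zero    (suc _) = 0ℤ
δ (suc _) zero    = 0ℤ
δ (suc s) (suc t) = δ s t

δ-refl : (s : Fin n) → δ s s ≡ 1ℤ
δ-refl zero    = refl
δ-refl (suc s) = δ-refl s

δ-≢ : {s t : Fin n} → s ≢ t → δ s t ≡ 0ℤ
δ-≢ {s = zero}  {zero}  s≢t = ⊥-elim (s≢t refl)
δ-≢ {s = zero}  {suc t} s≢t = refl
δ-≢ {s = suc s} {zero}  s≢t = refl
δ-≢ {s = suc s} {suc t} s≢t = δ-≢ (s≢t ∘ cong suc)

δ-sym : (s t : Fin n) → δ s t ≡ δ t s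
δ-sym zero    zero    = refl
δ-sym zero    (suc t) = refl
δ-sym (suc s) zero    = refl
δ-sym (suc s) (suc t) = δ-sym s t

∑-const : ∀ n c → ∑[ _ < n ] c ≡ + n * c
∑-const zero    c = refl
∑-const (suc n) c = trans (cong (_+_ c) (∑-const n c)) (sym (suc-* (+ n) c))

∑-one : ∀ n → ∑[ _ < n ] 1ℤ ≡ + n
∑-one n = trans (∑-const n 1ℤ) (*-identityʳ (+ n))

∑-zero : ∀ {f : Fin n → ℤ} → (∀ i → f i ≡ 0ℤ) → sum f ≡ 0ℤ
∑-zero {n} f≗0 = trans (sum-cong-≗ f≗0) (trans (∑-const n 0ℤ) (*-zeroʳ (+ n)))

∑-distrib-- : (f g : Fin n → ℤ) → ∑[ i < n ] (f i - g i) ≡ sum f - sum g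
∑-distrib-- f g = begin
  sum (λ i → f i + - g i)             ≡⟨ sum-cong-≗ (λ i → cong (_+_ (f i)) (-1*i≡-i (g i))) ⟨
  sum (λ i → f i + -1ℤ * g i)         ≡⟨ ∑-distrib-+ f _ ⟩
  sum f + sum (λ i → -1ℤ * g i)       ≡⟨ cong (_+_ (sum f)) (*-distribˡ-sum -1ℤ g) ⟨
  sum f + -1ℤ * sum g                 ≡⟨ cong (_+_ (sum f)) (-1*i≡-i (sum g)) ⟩
  sum f - sum g                       ∎
  where open ≡-Reasoning

∑-δ* : (s : Fin n) (f : Fin n → ℤ) → ∑[ t < n ] (δ s t * f t) ≡ f s
∑-δ* {suc n} zero f = trans (cong₂ _+_ (*-identityˡ (f zero)) (∑-zero {n} λ _ → refl)) (+-identityʳ (f zero))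
∑-δ* (suc s)      f = trans (+-identityˡ _) (∑-δ* s (f ∘ suc))

∑-δ : (s : Fin n) → sum (δ s) ≡ 1ℤ
∑-δ s = trans (sum-cong-≗ λ t → sym (*-identityʳ (δ s t))) (∑-δ* s λ _ → 1ℤ)

∑-mono-≤ : {f g : Fin n → ℤ} → (∀ i → f i ≤ g i) → sum f ≤ sum g
∑-mono-≤ {zero}  f≤g = ≤-refl
∑-mono-≤ {suc n} f≤g = +-mono-≤ (f≤g zero) (∑-mono-≤ (f≤g ∘ suc))

∑-nonneg : {f : Fin n → ℤ} → (∀ i → 0ℤ ≤ f i) → 0ℤ ≤ sum f
∑-nonneg {zero}  0≤f = ≤-refl
∑-nonneg {suc n} 0≤f = +-mono-≤ (0≤f zero) (∑-nonneg (0≤f ∘ suc))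

+-conical : ∀ {a b} → 0ℤ ≤ a → 0ℤ ≤ b → a + b ≡ 0ℤ → a ≡ 0ℤ × b ≡ 0ℤ
+-conical {+ zero} {+ zero} _ _ _ = refl , refl

-- Turns a tight count into pointwise information. It yields the adjacency of the members of a
-- clique, and later that the entries of the matrix `G` are zero or one.
∑≡0⇒≗0 : {f : Fin n → ℤ} → (∀ i → 0ℤ ≤ f i) → sum f ≡ 0ℤ → ∀ i → f i ≡ 0ℤ
∑≡0⇒≗0 {suc n} 0≤f ∑f≡0 i with +-conical (0≤f zero) (∑-nonneg (0≤f ∘ suc)) ∑f≡0
∑≡0⇒≗0 {suc n} 0≤f ∑f≡0 zero    | f₀≡0 , _    = f₀≡0
∑≡0⇒≗0 {suc n} 0≤f ∑f≡0 (suc i) | _    , ∑≡0 = ∑≡0⇒≗0 (0≤f ∘ suc) ∑≡0 i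

-- Zero-one valued functions

Bit : ℤ → Set
Bit z = z ≡ 0ℤ ⊎ z ≡ 1ℤ

bit-* : ∀ {a b} → Bit a → Bit b → Bit (a * b)
bit-* (inj₁ refl) _           = inj₁ refl
bit-* (inj₂ refl) (inj₁ refl) = inj₁ refl
bit-* (inj₂ refl) (inj₂ refl) = inj₂ refl

bit-idem : ∀ {a} → Bit a → a * a ≡ a
bit-idem (inj₁ refl) = refl
bit-idem (inj₂ refl) = refl

bit-complement : ∀ {a} → Bit a → Bit (1ℤ - a)
bit-complement (inj₁ refl) = inj₂ refl
bit-complement (inj₂ refl) = inj₁ refl

bit-nonneg : ∀ {a} → Bit a → 0ℤ ≤ a
bit-nonneg (inj₁ refl) = +≤+ z≤n
bit-nonneg (inj₂ refl) = +≤+ z≤n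

bits⁺ : ∀ {a b} → Bit a → Bit b → a * b ≡ 1ℤ → a ≡ 1ℤ × b ≡ 1ℤ
bits⁺ (inj₁ refl) _           ()
bits⁺ (inj₂ refl) (inj₁ refl) ()
bits⁺ (inj₂ refl) (inj₂ refl) _ = refl , refl

∑-bits≥1 : {f : Fin n → ℤ} → (∀ i → Bit (f i)) → 1ℤ ≤ sum f → ∃[ i ] f i ≡ 1ℤ
∑-bits≥1 {zero} _ (+≤+ ())
∑-bits≥1 {suc n} {f} bits 1≤∑ with bits zero
... | inj₂ f₀≡1 = zero , f₀≡1
... | inj₁ f₀≡0 with ∑-bits≥1 (bits ∘ suc)
                       (subst (1ℤ ≤_) (trans (cong (_+ sum (f ∘ suc)) f₀≡0) (+-identityˡ _)) 1≤∑)
...   | i , fᵢ≡1 = suc i , fᵢ≡1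

+-cancelˡ-≤ : ∀ {a b c} → a + b ≤ a + c → b ≤ c
+-cancelˡ-≤ {a} {b} {c} a+b≤a+c =
  subst₂ _≤_ (cancel a b) (cancel a c) (+-monoʳ-≤ (- a) a+b≤a+c)
  where
  cancel : ∀ a b → - a + (a + b) ≡ b
  cancel = solve-∀

suc≢ : {i j : Fin n} → i ≢ j → suc i ≢ suc j
suc≢ i≢j refl = i≢j refl

∑-bits≥2 : {f : Fin n → ℤ} → (∀ i → Bit (f i)) → + 2 ≤ sum f →
           ∃[ i ] ∃[ j ] (i ≢ j × f i ≡ 1ℤ × f j ≡ 1ℤ)
∑-bits≥2 {zero} _ (+≤+ ())
∑-bits≥2 {suc n} {f} bits 2≤∑ with bits zero
... | inj₂ f₀≡1 with ∑-bits≥1 (bits ∘ suc)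
                       (+-cancelˡ-≤ {1ℤ} (subst (+ 2 ≤_) (cong (_+ sum (f ∘ suc)) f₀≡1) 2≤∑))
...   | j , fⱼ≡1 = zero , suc j , (λ ()) , f₀≡1 , fⱼ≡1
∑-bits≥2 {suc n} {f} bits 2≤∑ | inj₁ f₀≡0 with ∑-bits≥2 (bits ∘ suc)
                       (subst (+ 2 ≤_) (trans (cong (_+ sum (f ∘ suc)) f₀≡0) (+-identityˡ _)) 2≤∑)
...   | i , j , i≢j , fᵢ≡1 , fⱼ≡1 = suc i , suc j , suc≢ i≢j , fᵢ≡1 , fⱼ≡1

-- Cliques in the adjacency graph

-- The order is a variable with an equation, so that sums over `Fin n` stay folded instead of being
-- unrolled into fifteen terms. `G²` says that the graph is strongly regular with parameters (15, 8,
-- 4, 4).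
module Graph
  {n} (n≡15 : n ≡ 15)
  (G        : Fin n → Fin n → ℤ)
  (G-bit    : ∀ s t → Bit (G s t))
  (G-irrefl : ∀ s → G s s ≡ 0ℤ)
  (G-sym    : ∀ s t → G s t ≡ G t s)
  (G²       : ∀ s t → ∑[ u < n ] (G s u * G t u) ≡ + 4 + + 4 * δ s t)
  where

  -- By `degree`, a member has four neighbours in the set, hence all other members, and a vertex
  -- outside has two. These are the cliques attaining the Delsarte bound 1 + 8/2. Stating the
  -- condition linearly in `x` makes it easy to verify and to combine.
  record Clique (x : Fin n → ℤ) : Set where
    field
      bit    : ∀ s → Bit (x s)
      size   : sum x ≡ + 5
      degree : ∀ s → ∑[ t < n ] (G s t * x t) ≡ + 2 + + 2 * x s

  open Clique

  order : ∑[ _ < n ] 1ℤ ≡ + 15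
  order = trans (∑-one n) (cong +_ n≡15)

  G-degree : ∀ s → sum (G s) ≡ + 8
  G-degree s = begin
    sum (G s)                    ≡⟨ sum-cong-≗ (λ t → bit-idem (G-bit s t)) ⟨
    ∑[ t < n ] (G s t * G s t)  ≡⟨ G² s s ⟩
    + 4 + + 4 * δ s s            ≡⟨ cong (λ d → + 4 + + 4 * d) (δ-refl s) ⟩
    + 8                          ∎
    where open ≡-Reasoning

  adjacent⇒≢ : ∀ {s t} → G s t ≡ 1ℤ → s ≢ t
  adjacent⇒≢ {s} Gₛₛ≡1 refl with trans (sym Gₛₛ≡1) (G-irrefl s)
  ... | ()

  common-neighbours : ∀ {s t} → s ≢ t → ∑[ u < n ] (G s u * G t u) ≡ + 4
  common-neighbours {s} {t} s≢t = trans (G² s t) (cong (λ d → + 4 + + 4 * d) (δ-≢ s≢t))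

  module _ {x} (X : Clique x) where

    -- The four neighbours that s has among the members of X are all the other members.
    neighbours-in-clique : ∀ {s} → x s ≡ 1ℤ → ∀ t → G s t * x t ≡ x t - δ s t
    neighbours-in-clique {s} xₛ≡1 t =
      sym (i-j≡0⇒i≡j _ _ (∑≡0⇒≗0 nonneg total t))
      where
      nonneg-at : ∀ {g a} → Bit g → Bit a → 0ℤ ≤ a - 0ℤ - g * a
      nonneg-at (inj₁ refl) (inj₁ refl) = +≤+ z≤n
      nonneg-at (inj₁ refl) (inj₂ refl) = +≤+ z≤n
      nonneg-at (inj₂ refl) (inj₁ refl) = +≤+ z≤n
      nonneg-at (inj₂ refl) (inj₂ refl) = +≤+ z≤n

      nonneg : ∀ t → 0ℤ ≤ x t - δ s t - G s t * x t
      nonneg t with s ≟ t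
      ... | yes refl rewrite δ-refl s | xₛ≡1 | G-irrefl s = ≤-refl
      ... | no s≢t rewrite δ-≢ s≢t = nonneg-at (G-bit s t) (bit X t)

      total : ∑[ t < n ] (x t - δ s t - G s t * x t) ≡ 0ℤ
      total
        rewrite ∑-distrib-- (λ t → x t - δ s t) (λ t → G s t * x t)
              | ∑-distrib-- x (δ s) | size X | ∑-δ s | degree X s | xₛ≡1 = refl

    adjacent : ∀ {s t} → x s ≡ 1ℤ → x t ≡ 1ℤ → s ≢ t → G s t ≡ 1ℤ
    adjacent {s} {t} xₛ≡1 xₜ≡1 s≢t with neighbours-in-clique xₛ≡1 t
    ... | eq rewrite xₜ≡1 | δ-≢ s≢t | *-identityʳ (G s t) = eq

    -- The neighbours of `s` in the clique are its members other than `s`, so this is the number of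
    -- neighbours of `t` in the clique, less one if `s` is among them.
    common-neighbours-inside : ∀ {s} → x s ≡ 1ℤ → ∀ t →
      ∑[ u < n ] (G s u * G t u * x u) ≡ + 2 + + 2 * x t - G s t
    common-neighbours-inside {s} xₛ≡1 t = begin
      ∑[ u < n ] (G s u * G t u * x u)
        ≡⟨ sum-cong-≗ (λ u → trans (reorder (G s u) (G t u) (x u))
             (trans (cong (_* G t u) (neighbours-in-clique xₛ≡1 u))
                    (expand (G t u) (x u) (δ s u)))) ⟩
      ∑[ u < n ] (G t u * x u - δ s u * G t u)
        ≡⟨ ∑-distrib-- (λ u → G t u * x u) _ ⟩
      ∑[ u < n ] (G t u * x u) - ∑[ u < n ] (δ s u * G t u)
        ≡⟨ cong₂ _-_ (degree X t) (trans (∑-δ* s (G t)) (G-sym t s)) ⟩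
      + 2 + + 2 * x t - G s t ∎
      where
      open ≡-Reasoning
      reorder : ∀ a b c → a * b * c ≡ a * c * b
      reorder = solve-∀
      expand : ∀ b c d → (c - d) * b ≡ b * c - d * b
      expand = solve-∀

    -- Of the four common neighbours of `s` and `t`, three are the remaining members of the clique.
    common-neighbours-outside : ∀ {s t} → x s ≡ 1ℤ → x t ≡ 1ℤ → s ≢ t →
      ∑[ u < n ] (G s u * G t u * (1ℤ - x u)) ≡ 1ℤ
    common-neighbours-outside {s} {t} xₛ≡1 xₜ≡1 s≢t = begin
      ∑[ u < n ] (G s u * G t u * (1ℤ - x u))
        ≡⟨ sum-cong-≗ (λ u → expand (G s u * G t u) (x u)) ⟩
      ∑[ u < n ] (G s u * G t u - G s u * G t u * x u)
        ≡⟨ ∑-distrib-- (λ u → G s u * G t u) _ ⟩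
      ∑[ u < n ] (G s u * G t u) - ∑[ u < n ] (G s u * G t u * x u)
        ≡⟨ cong₂ _-_ (common-neighbours s≢t) (common-neighbours-inside xₛ≡1 t) ⟩
      + 4 - (+ 2 + + 2 * x t - G s t)
        ≡⟨ cong₂ (λ a g → + 4 - (+ 2 + + 2 * a - g)) xₜ≡1 (adjacent xₛ≡1 xₜ≡1 s≢t) ⟩
      1ℤ ∎
      where
      open ≡-Reasoning
      expand : ∀ a b → a * (1ℤ - b) ≡ a - a * b
      expand = solve-∀

  member≢nonmember : ∀ {x : Fin n → ℤ} {s t} → x s ≡ 1ℤ → x t ≡ 0ℤ → s ≢ t
  member≢nonmember xₛ≡1 xₛ≡0 refl with trans (sym xₛ≡1) xₛ≡0
  ... | ()

  module _ {x y} (X : Clique x) (Y : Clique y) where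

    meet-bit : ∀ s → Bit (x s * y s)
    meet-bit s = bit-* (bit X s) (bit Y s)

    ∑-difference : ∑[ u < n ] (y u * (1ℤ - x u)) ≡ + 5 - ∑[ u < n ] (x u * y u)
    ∑-difference = begin
      ∑[ u < n ] (y u * (1ℤ - x u))  ≡⟨ sum-cong-≗ (λ u → expand (x u) (y u)) ⟩
      ∑[ u < n ] (y u - x u * y u)   ≡⟨ ∑-distrib-- y _ ⟩
      sum y - ∑[ u < n ] (x u * y u) ≡⟨ cong (_- ∑[ u < n ] (x u * y u)) (size Y) ⟩
      + 5 - ∑[ u < n ] (x u * y u)   ∎
      where
      open ≡-Reasoning
      expand : ∀ a b → b * (1ℤ - a) ≡ b - a * b
      expand = solve-∀

    -- A member of Y outside X is adjacent to all of X ∩ Y, and has two neighbours in X.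
    meet-≤2 : ∀ {u} → y u ≡ 1ℤ → x u ≡ 0ℤ → ∑[ t < n ] (x t * y t) ≤ + 2
    meet-≤2 {u} yᵤ≡1 xᵤ≡0 =
      subst (∑[ t < n ] (x t * y t) ≤_)
            (trans (degree X u) (cong (λ a → + 2 + + 2 * a) xᵤ≡0))
            (∑-mono-≤ bound)
      where
      bound : ∀ t → x t * y t ≤ G u t * x t
      bound t with bit X t | bit Y t
      ... | inj₁ xₜ≡0 | _ rewrite xₜ≡0 | *-zeroʳ (G u t) = ≤-refl
      ... | inj₂ xₜ≡1 | inj₁ yₜ≡0 rewrite xₜ≡1 | yₜ≡0 =
        bit-nonneg (bit-* (G-bit u t) (inj₂ refl))
      ... | inj₂ xₜ≡1 | inj₂ yₜ≡1
        rewrite adjacent Y yᵤ≡1 yₜ≡1 (λ u≡t → member≢nonmember xₜ≡1 xᵤ≡0 (sym u≡t))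
              | xₜ≡1 | yₜ≡1 = ≤-refl

    -- The members of Y outside X are common neighbours of s and t outside X.
    difference-≤1 : ∀ {s t} → s ≢ t → x s * y s ≡ 1ℤ → x t * y t ≡ 1ℤ →
      + 5 - ∑[ u < n ] (x u * y u) ≤ 1ℤ
    difference-≤1 {s} {t} s≢t xyₛ≡1 xyₜ≡1
      with bits⁺ (bit X s) (bit Y s) xyₛ≡1 | bits⁺ (bit X t) (bit Y t) xyₜ≡1
    ... | xₛ≡1 , yₛ≡1 | xₜ≡1 , yₜ≡1 =
      subst₂ _≤_ ∑-difference (common-neighbours-outside X xₛ≡1 xₜ≡1 s≢t) (∑-mono-≤ bound)
      where
      bound : ∀ u → y u * (1ℤ - x u) ≤ G s u * G t u * (1ℤ - x u)
      bound u with bit X u | bit Y u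
      ... | inj₂ xᵤ≡1 | _ rewrite xᵤ≡1 | *-zeroʳ (y u) | *-zeroʳ (G s u * G t u) = ≤-refl
      ... | inj₁ xᵤ≡0 | inj₁ yᵤ≡0 rewrite xᵤ≡0 | yᵤ≡0 =
        bit-nonneg (bit-* (bit-* (G-bit s u) (G-bit t u)) (inj₂ refl))
      ... | inj₁ xᵤ≡0 | inj₂ yᵤ≡1
        rewrite adjacent Y yₛ≡1 yᵤ≡1 (member≢nonmember xₛ≡1 xᵤ≡0)
              | adjacent Y yₜ≡1 yᵤ≡1 (member≢nonmember xₜ≡1 xᵤ≡0)
              | xᵤ≡0 | yᵤ≡1 = ≤-refl

    -- Excluding disjoint cliques

    module _ (disjoint : ∀ s → x s * y s ≡ 0ℤ) where

      z : Fin n → ℤ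
      z s = 1ℤ - x s - y s

      -- The graph is regular of degree 8 and the clique conditions are affine in the indicator, so
      -- subtracting those for `x` and `y` leaves those for the remaining five vertices.
      complement : Clique z
      complement .bit s with bit X s | bit Y s | disjoint s
      ... | inj₁ xₛ≡0 | inj₁ yₛ≡0 | _ rewrite xₛ≡0 | yₛ≡0 = inj₂ refl
      ... | inj₁ xₛ≡0 | inj₂ yₛ≡1 | _ rewrite xₛ≡0 | yₛ≡1 = inj₁ refl
      ... | inj₂ xₛ≡1 | inj₁ yₛ≡0 | _ rewrite xₛ≡1 | yₛ≡0 = inj₁ refl
      ... | inj₂ xₛ≡1 | inj₂ yₛ≡1 | xyₛ≡0 rewrite xₛ≡1 | yₛ≡1 with xyₛ≡0
      ...   | ()
      complement .size
        rewrite ∑-distrib-- (λ s → 1ℤ - x s) y | ∑-distrib-- (λ _ → 1ℤ) x | order | size X | size Y = refl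
      complement .degree s = begin
        ∑[ t < n ] (G s t * (1ℤ - x t - y t))
          ≡⟨ sum-cong-≗ (λ t → expand (G s t) (x t) (y t)) ⟩
        ∑[ t < n ] (G s t - G s t * x t - G s t * y t)
          ≡⟨ ∑-distrib-- (λ t → G s t - G s t * x t) _ ⟩
        ∑[ t < n ] (G s t - G s t * x t) - ∑[ t < n ] (G s t * y t)
          ≡⟨ cong₂ _-_ (trans (∑-distrib-- (G s) _) (cong₂ _-_ (G-degree s) (degree X s))) (degree Y s) ⟩
        + 8 - (+ 2 + + 2 * x s) - (+ 2 + + 2 * y s)
          ≡⟨ collect (x s) (y s) ⟩
        + 2 + + 2 * z s ∎
        where
        open ≡-Reasoning
        expand : ∀ g a b → g * (1ℤ - a - b) ≡ g - g * a - g * b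
        expand = solve-∀
        collect : ∀ a b → + 8 - (+ 2 + + 2 * a) - (+ 2 + + 2 * b) ≡ + 2 + + 2 * (1ℤ - a - b)
        collect = solve-∀

      z-excludes : ∀ {s} → x s ≡ 1ℤ ⊎ y s ≡ 1ℤ → z s ≡ 0ℤ
      z-excludes {s} _ with bit X s | bit Y s | disjoint s
      z-excludes (inj₁ xₛ≡1) | inj₂ _    | inj₁ yₛ≡0 | _ rewrite xₛ≡1 | yₛ≡0 = refl
      z-excludes (inj₁ xₛ≡1) | inj₁ xₛ≡0 | _ | _ with trans (sym xₛ≡1) xₛ≡0
      ... | ()
      z-excludes (inj₂ yₛ≡1) | inj₁ xₛ≡0 | _ | _ rewrite xₛ≡0 | yₛ≡1 = refl
      z-excludes (inj₂ yₛ≡1) | inj₂ _ | inj₁ yₛ≡0 | _ with trans (sym yₛ≡1) yₛ≡0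
      ... | ()
      z-excludes _ | inj₂ xₛ≡1 | inj₂ yₛ≡1 | xyₛ≡0 rewrite xₛ≡1 | yₛ≡1 with xyₛ≡0
      ... | ()

      -- Of the four common neighbours, `common-neighbours-inside` places 2 - 1 = 1 in each of the
      -- two given cliques.
      ∑-common-neighbours-in-z : ∀ {s t} → x s ≡ 1ℤ → y t ≡ 1ℤ → s ≢ t → G s t ≡ 1ℤ →
        ∑[ u < n ] (G s u * G t u * z u) ≡ + 2
      ∑-common-neighbours-in-z {s} {t} xₛ≡1 yₜ≡1 s≢t Gₛₜ≡1 = begin
        ∑[ u < n ] (G s u * G t u * z u)
          ≡⟨ sum-cong-≗ (λ u → expand (G s u) (G t u) (x u) (y u)) ⟩
        ∑[ u < n ] (G s u * G t u - G s u * G t u * x u - G t u * G s u * y u)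
          ≡⟨ ∑-distrib-- (λ u → G s u * G t u - G s u * G t u * x u) _ ⟩
        ∑[ u < n ] (G s u * G t u - G s u * G t u * x u) - ∑[ u < n ] (G t u * G s u * y u)
          ≡⟨ cong₂ _-_
               (trans (∑-distrib-- (λ u → G s u * G t u) _)
                      (cong₂ _-_ (common-neighbours s≢t) (common-neighbours-inside X xₛ≡1 t)))
               (common-neighbours-inside Y yₜ≡1 s) ⟩
        + 4 - (+ 2 + + 2 * x t - G s t) - (+ 2 + + 2 * y s - G t s)
          ≡⟨ cong₂ (λ a b → + 4 - (+ 2 + + 2 * a - G s t) - (+ 2 + + 2 * b - G t s)) xₜ≡0 yₛ≡0 ⟩
        + 4 - (+ 2 - G s t) - (+ 2 - G t s)
          ≡⟨ cong₂ (λ a b → + 4 - (+ 2 - a) - (+ 2 - b)) Gₛₜ≡1 (trans (G-sym t s) Gₛₜ≡1) ⟩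
        + 2 ∎
        where
        open ≡-Reasoning
        expand : ∀ g h a b → g * h * (1ℤ - a - b) ≡ g * h - g * h * a - h * g * b
        expand = solve-∀
        xₜ≡0 : x t ≡ 0ℤ
        xₜ≡0 = trans (sym (*-identityʳ (x t))) (trans (cong (x t *_) (sym yₜ≡1)) (disjoint t))
        yₛ≡0 : y s ≡ 0ℤ
        yₛ≡0 = trans (sym (*-identityˡ (y s))) (trans (cong (_* y s) (sym xₛ≡1)) (disjoint s))

      -- Adjacent s ∈ X and t ∈ Y would have two common neighbours u, v in Z, which then
      -- have the two common neighbours s, t outside Z.
      ¬adjacent : ∀ {s t} → x s ≡ 1ℤ → y t ≡ 1ℤ → G s t ≢ 1ℤ
      ¬adjacent {s} {t} xₛ≡1 yₜ≡1 Gₛₜ≡1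
        with ∑-bits≥2 (λ u → bit-* (bit-* (G-bit s u) (G-bit t u)) (bit complement u))
               (≤-reflexive (sym (∑-common-neighbours-in-z xₛ≡1 yₜ≡1 (adjacent⇒≢ Gₛₜ≡1) Gₛₜ≡1)))
      ... | u , v , u≢v , fᵤ≡1 , fᵥ≡1
        with bits⁺ (bit-* (G-bit s u) (G-bit t u)) (bit complement u) fᵤ≡1
           | bits⁺ (bit-* (G-bit s v) (G-bit t v)) (bit complement v) fᵥ≡1
      ... | GGᵤ≡1 , zᵤ≡1 | GGᵥ≡1 , zᵥ≡1
        with bits⁺ (G-bit s u) (G-bit t u) GGᵤ≡1 | bits⁺ (G-bit s v) (G-bit t v) GGᵥ≡1
      ... | Gₛᵤ≡1 , Gₜᵤ≡1 | Gₛᵥ≡1 , Gₜᵥ≡1 = absurd (subst₂ _≤_ ∑-two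
              (common-neighbours-outside complement zᵤ≡1 zᵥ≡1 u≢v) (∑-mono-≤ bound))
        where
        absurd : ¬ (+ 2 ≤ 1ℤ)
        absurd (+≤+ (s≤s ()))
        ∑-two : ∑[ w < n ] (δ s w + δ t w) ≡ + 2
        ∑-two = trans (∑-distrib-+ (δ s) (δ t)) (cong₂ _+_ (∑-δ s) (∑-δ t))
        bound : ∀ w → δ s w + δ t w ≤ G u w * G v w * (1ℤ - z w)
        bound w with s ≟ w | t ≟ w
        ... | yes refl | yes refl = ⊥-elim (adjacent⇒≢ Gₛₜ≡1 refl)
        ... | yes refl | no t≢w
          rewrite δ-refl s | δ-≢ t≢w | G-sym u s | G-sym v s | Gₛᵤ≡1 | Gₛᵥ≡1
                | z-excludes (inj₁ xₛ≡1) = ≤-refl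
        ... | no s≢w | yes refl
          rewrite δ-refl t | δ-≢ s≢w | G-sym u t | G-sym v t | Gₜᵤ≡1 | Gₜᵥ≡1
                | z-excludes (inj₂ yₜ≡1) = ≤-refl
        ... | no s≢w | no t≢w rewrite δ-≢ s≢w | δ-≢ t≢w =
          bit-nonneg (bit-* (bit-* (G-bit u w) (G-bit v w)) (bit-complement (bit complement w)))

      -- Any member `s` of the first clique has at least two neighbours in the second, against
      -- `¬adjacent`.
      ¬disjoint : ⊥
      ¬disjoint with ∑-bits≥1 (bit X) (subst (1ℤ ≤_) (sym (size X)) (+≤+ (s≤s z≤n)))
      ... | s , xₛ≡1
        with ∑-bits≥1 (λ t → bit-* (G-bit s t) (bit Y t))
               (subst (1ℤ ≤_) (sym (degree Y s))
                 (+-mono-≤ {1ℤ} {+ 2} (+≤+ (s≤s z≤n)) (*-monoˡ-≤-nonNeg (+ 2) (bit-nonneg (bit Y s)))))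
      ...   | t , Gy≡1 with bits⁺ (G-bit s t) (bit Y t) Gy≡1
      ...     | Gₛₜ≡1 , yₜ≡1 = ¬adjacent xₛ≡1 yₜ≡1 Gₛₜ≡1

    contained-or-witness : (∀ u → y u * (1ℤ - x u) ≡ 0ℤ) ⊎ ∃[ u ] (y u ≡ 1ℤ × x u ≡ 0ℤ)
    contained-or-witness with any? (λ u → y u * (1ℤ - x u) ℤ.≟ 1ℤ)
    ... | yes (u , yx̄≡1) with bits⁺ (bit Y u) (bit-complement (bit X u)) yx̄≡1
    ...   | yᵤ≡1 , x̄ᵤ≡1 = inj₂ (u , yᵤ≡1 , flip (bit X u) x̄ᵤ≡1)
      where
      flip : ∀ {a} → Bit a → 1ℤ - a ≡ 1ℤ → a ≡ 0ℤ
      flip (inj₁ a≡0) _ = a≡0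
      flip (inj₂ refl) ()
    contained-or-witness | no none = inj₁ λ u → zero-at u (bit-* (bit Y u) (bit-complement (bit X u)))
      where
      zero-at : ∀ u → Bit (y u * (1ℤ - x u)) → y u * (1ℤ - x u) ≡ 0ℤ
      zero-at u (inj₁ ≡0) = ≡0
      zero-at u (inj₂ ≡1) = ⊥-elim (none (u , ≡1))

    -- If the second clique is not contained in the first, they share at most two vertices, leaving
    -- at least three outside; but two shared vertices would allow only one outside. Hence fewer
    -- than two are shared, and `¬disjoint` rules out none. The witness `e` is 1 for containment and
    -- 0 otherwise, a form suited to summing modulo 4.
    meet≡1or5 : ∃[ e ] ∑[ u < n ] (x u * y u) ≡ 1ℤ + + 4 * e
    meet≡1or5 with contained-or-witness
    ... | inj₁ y⊆x = 1ℤ , sym (i-j≡0⇒i≡j _ _ (trans (sym ∑-difference) (∑-zero y⊆x)))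
    ... | inj₂ (u , yᵤ≡1 , xᵤ≡0) = 0ℤ , exactly-one _ (∑-nonneg (bit-nonneg ∘ meet-bit)) ≢0 ≱2
      where
      ≢0 : ∑[ u < n ] (x u * y u) ≢ 0ℤ
      ≢0 ∑≡0 = ¬disjoint (∑≡0⇒≗0 (bit-nonneg ∘ meet-bit) ∑≡0)
      ≱2 : ¬ (+ 2 ≤ ∑[ u < n ] (x u * y u))
      ≱2 2≤∑ with ∑-bits≥2 meet-bit 2≤∑
      ... | s , t , s≢t , xyₛ≡1 , xyₜ≡1 = absurd (≤-trans
              (+-monoʳ-≤ (+ 5) (neg-mono-≤ (meet-≤2 yᵤ≡1 xᵤ≡0)))
              (difference-≤1 s≢t xyₛ≡1 xyₜ≡1))
        where
        absurd : ¬ (+ 3 ≤ 1ℤ)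
        absurd (+≤+ (s≤s ()))
      exactly-one : ∀ k → 0ℤ ≤ k → k ≢ 0ℤ → ¬ (+ 2 ≤ k) → k ≡ 1ℤ
      exactly-one (+ 0)           _ k≢0 _   = ⊥-elim (k≢0 refl)
      exactly-one (+ 1)           _ _   _   = refl
      exactly-one (+ suc (suc _)) _ _   k≱2 = ⊥-elim (k≱2 (+≤+ (s≤s (s≤s z≤n))))
-- Counting in the two incidence structures

-- X i s and Y j s tell whether the symbol s occurs in row i and in column j.
module Counting
  {r c v} (r≡9 : r ≡ 9) (c≡10 : c ≡ 10) (v≡15 : v ≡ 15)
  (X : Fin r → Fin v → ℤ) (X-bit : ∀ i s → Bit (X i s))
  (row-size : ∀ i → sum (X i) ≡ + 10)
  (row-replication : ∀ s → ∑[ i < r ] X i s ≡ + 6)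
  (Y : Fin c → Fin v → ℤ) (Y-bit : ∀ j s → Bit (Y j s))
  (column-size : ∀ j → sum (Y j) ≡ + 9)
  (column-replication : ∀ s → ∑[ j < c ] Y j s ≡ + 6)
  (λcc : ℤ) (cc : ∀ j j′ → j ≢ j′ → ∑[ s < v ] (Y j s * Y j′ s) ≡ λcc)
  (λrc : ℤ) (rc : ∀ i j → ∑[ s < v ] (X i s * Y j s) ≡ λrc)
  where

  open ≡-Reasoning

  -- Double counting: every symbol lies in six columns. Taking a column for `f` determines `λcc`,
  -- taking a row determines `λrc`.
  columns-through : ∀ (f : Fin v → ℤ) →
    ∑[ j < c ] ∑[ s < v ] (f s * Y j s) ≡ sum f * + 6
  columns-through f = begin
    ∑[ j < c ] ∑[ s < v ] (f s * Y j s)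
      ≡⟨ ∑-comm (λ j s → f s * Y j s) ⟩
    ∑[ s < v ] ∑[ j < c ] (f s * Y j s)
      ≡⟨ sum-cong-≗ (λ s → trans (sym (*-distribˡ-sum (f s) (λ j → Y j s)))
                                 (cong (f s *_) (column-replication s))) ⟩
    ∑[ s < v ] (f s * + 6)
      ≡⟨ *-distribʳ-sum (+ 6) f ⟨
    sum f * + 6 ∎

  column-meet : ∀ j j′ → ∑[ s < v ] (Y j s * Y j′ s) ≡ λcc + (+ 9 - λcc) * δ j j′
  column-meet j j′ with j ≟ j′
  ... | yes refl = begin
    ∑[ s < v ] (Y j s * Y j s)   ≡⟨ sum-cong-≗ (λ s → bit-idem (Y-bit j s)) ⟩
    sum (Y j)                    ≡⟨ column-size j ⟩
    + 9                          ≡⟨ collect λcc ⟨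
    λcc + (+ 9 - λcc) * 1ℤ       ≡⟨ cong (λ d → λcc + (+ 9 - λcc) * d) (δ-refl j) ⟨
    λcc + (+ 9 - λcc) * δ j j    ∎
    where
    collect : ∀ l → l + (+ 9 - l) * 1ℤ ≡ + 9
    collect = solve-∀
  ... | no j≢j′ = begin
    ∑[ s < v ] (Y j s * Y j′ s)  ≡⟨ cc j j′ j≢j′ ⟩
    λcc                          ≡⟨ collect λcc ⟨
    λcc + (+ 9 - λcc) * 0ℤ       ≡⟨ cong (λ d → λcc + (+ 9 - λcc) * d) (δ-≢ j≢j′) ⟨
    λcc + (+ 9 - λcc) * δ j j′   ∎
    where
    collect : ∀ l → l + (+ 9 - l) * 0ℤ ≡ l
    collect = solve-∀

  ∑-affine-δ : ∀ {k} a b (s : Fin k) → ∑[ t < k ] (a + b * δ s t) ≡ + k * a + b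
  ∑-affine-δ {k} a b s = begin
    ∑[ t < k ] (a + b * δ s t)              ≡⟨ ∑-distrib-+ {k} (λ _ → a) (λ t → b * δ s t) ⟩
    ∑[ t < k ] a + ∑[ t < k ] (b * δ s t)   ≡⟨ cong₂ _+_ (∑-const k a) (sym (*-distribˡ-sum b (δ s))) ⟩
    + k * a + b * sum (δ s)                 ≡⟨ cong (λ d → + k * a + b * d) (∑-δ s) ⟩
    + k * a + b * 1ℤ                        ≡⟨ cong (λ x → + k * a + x) (*-identityʳ b) ⟩
    + k * a + b                             ∎

  -- The symbols of a fixed column account for 9 * 6 incidences with all columns. Nine of these are
  -- with the column itself, and the nine other columns share the remaining 45 equally.
  λcc≡5 : λcc ≡ + 5
  λcc≡5 = *-cancelˡ-≡ (+ 9) _ _ (begin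
    + 9 * λcc                           ≡⟨ collect λcc ⟩
    + 10 * λcc + (+ 9 - λcc) - + 9      ≡⟨ cong (λ k → + k * λcc + (+ 9 - λcc) - + 9) c≡10 ⟨
    + c * λcc + (+ 9 - λcc) - + 9       ≡⟨ cong (_- + 9) (∑-affine-δ λcc (+ 9 - λcc) j) ⟨
    ∑[ j′ < c ] (λcc + (+ 9 - λcc) * δ j j′) - + 9
                                        ≡⟨ cong (_- + 9) (sum-cong-≗ (column-meet j)) ⟨
    ∑[ j′ < c ] ∑[ s < v ] (Y j s * Y j′ s) - + 9
                                        ≡⟨ cong (_- + 9) (columns-through (Y j)) ⟩
    sum (Y j) * + 6 - + 9               ≡⟨ cong (λ k → k * + 6 - + 9) (column-size j) ⟩
    + 45                                ∎)
    where
    j : Fin c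
    j = subst Fin (sym c≡10) zero
    collect : ∀ l → + 9 * l ≡ + 10 * l + (+ 9 - l) - + 9
    collect = solve-∀

  λrc≡6 : λrc ≡ + 6
  λrc≡6 = *-cancelˡ-≡ (+ 10) _ _ (begin
    + 10 * λrc                               ≡⟨ cong (λ k → + k * λrc) c≡10 ⟨
    + c * λrc                                ≡⟨ ∑-const c λrc ⟨
    ∑[ j < c ] λrc                           ≡⟨ sum-cong-≗ (rc i) ⟨
    ∑[ j < c ] ∑[ s < v ] (X i s * Y j s)    ≡⟨ columns-through (X i) ⟩
    sum (X i) * + 6                          ≡⟨ cong (_* + 6) (row-size i) ⟩
    + 60                                     ∎)
    where
    i : Fin r
    i = subst Fin (sym r≡9) zero

  column-meet′ : ∀ j j′ → ∑[ s < v ] (Y j s * Y j′ s) ≡ + 5 + + 4 * δ j j′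
  column-meet′ j j′ = trans (column-meet j j′) (cong (λ l → l + (+ 9 - l) * δ j j′) λcc≡5)

  -- The number of columns missing both s and t is ∑ⱼ YⱼₛYⱼₜ − 2; it is 4 if s = t, and
  -- otherwise 1 or 2 (by G-bit).  So this is the adjacency matrix of the graph of pairs
  -- of symbols jointly missing from just one column.
  G : Fin v → Fin v → ℤ
  G s t = + 4 + + 2 * δ s t - ∑[ j < c ] (Y j s * Y j t)

  -- Reads `G` as the operator 4J + 2I - YᵀY and applies Y and Yᵀ in turn, so that only the inner
  -- products of `f` with the columns have to be known.
  G-act : ∀ s f → ∑[ t < v ] (G s t * f t) ≡
          + 4 * sum f + + 2 * f s - ∑[ j < c ] (Y j s * ∑[ t < v ] (Y j t * f t))
  G-act s f = begin
    ∑[ t < v ] (G s t * f t)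
      ≡⟨ sum-cong-≗ (λ t → expand (δ s t) (f t) (∑[ j < c ] (Y j s * Y j t))) ⟩
    ∑[ t < v ] (+ 4 * f t + + 2 * (δ s t * f t) - ∑[ j < c ] (Y j s * Y j t) * f t)
      ≡⟨ ∑-distrib-- (λ t → + 4 * f t + + 2 * (δ s t * f t)) _ ⟩
    ∑[ t < v ] (+ 4 * f t + + 2 * (δ s t * f t)) - ∑[ t < v ] (∑[ j < c ] (Y j s * Y j t) * f t)
      ≡⟨ cong₂ _-_ scalar-part (trans (sum-cong-≗ λ t → *-distribʳ-sum (f t) (λ j → Y j s * Y j t))
                                      (trans (∑-comm (λ t j → Y j s * Y j t * f t)) (sum-cong-≗ pull-out))) ⟩
    + 4 * sum f + + 2 * f s - ∑[ j < c ] (Y j s * ∑[ t < v ] (Y j t * f t)) ∎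
    where
    expand : ∀ d x y → (+ 4 + + 2 * d - y) * x ≡ + 4 * x + + 2 * (d * x) - y * x
    expand = solve-∀
    scalar-part : ∑[ t < v ] (+ 4 * f t + + 2 * (δ s t * f t)) ≡ + 4 * sum f + + 2 * f s
    scalar-part = begin
      ∑[ t < v ] (+ 4 * f t + + 2 * (δ s t * f t))
        ≡⟨ ∑-distrib-+ (λ t → + 4 * f t) _ ⟩
      ∑[ t < v ] (+ 4 * f t) + ∑[ t < v ] (+ 2 * (δ s t * f t))
        ≡⟨ cong₂ _+_ (*-distribˡ-sum (+ 4) f) (*-distribˡ-sum (+ 2) (λ t → δ s t * f t)) ⟨
      + 4 * sum f + + 2 * ∑[ t < v ] (δ s t * f t)
        ≡⟨ cong (λ a → + 4 * sum f + + 2 * a) (∑-δ* s f) ⟩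
      + 4 * sum f + + 2 * f s ∎
    pull-out : ∀ j → ∑[ t < v ] (Y j s * Y j t * f t) ≡ Y j s * ∑[ t < v ] (Y j t * f t)
    pull-out j = trans (sum-cong-≗ λ t → *-assoc (Y j s) (Y j t) (f t))
                       (sym (*-distribˡ-sum (Y j s) (λ t → Y j t * f t)))

  -- The quadratic equation for the adjacency matrix

  Y*const : ∀ s a → ∑[ j < c ] (Y j s * a) ≡ + 6 * a
  Y*const s a = trans (sym (*-distribʳ-sum a (λ j → Y j s))) (cong (_* a) (column-replication s))

  YᵀY-diagonal : ∀ s → ∑[ j < c ] (Y j s * Y j s) ≡ + 6
  YᵀY-diagonal s = trans (sum-cong-≗ λ j → bit-idem (Y-bit j s)) (column-replication s)

  G-irrefl : ∀ s → G s s ≡ 0ℤ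
  G-irrefl s = cong₂ (λ d k → + 4 + + 2 * d - k) (δ-refl s) (YᵀY-diagonal s)

  G-sym : ∀ s t → G s t ≡ G t s
  G-sym s t = cong₂ (λ d k → + 4 + + 2 * d - k) (δ-sym s t) (sum-cong-≗ λ j → *-comm (Y j s) (Y j t))

  order : ∑[ _ < v ] 1ℤ ≡ + 15
  order = trans (∑-one v) (cong +_ v≡15)

  G-degree : ∀ s → sum (G s) ≡ + 8
  G-degree s = begin
    sum (G s)
      ≡⟨ sum-cong-≗ (λ t → *-identityʳ (G s t)) ⟨
    ∑[ t < v ] (G s t * 1ℤ)
      ≡⟨ G-act s (λ _ → 1ℤ) ⟩
    + 4 * ∑[ _ < v ] 1ℤ + + 2 - ∑[ j < c ] (Y j s * ∑[ t < v ] (Y j t * 1ℤ))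
      -- Each column contributes its size 9, and six columns contain `s`: 60 + 2 - 54 = 8.
      ≡⟨ cong₂ (λ a b → + 4 * a + + 2 - b) order
           (trans (sum-cong-≗ λ j → cong (Y j s *_)
                    (trans (sum-cong-≗ λ t → *-identityʳ (Y j t)) (column-size j)))
                  (Y*const s (+ 9))) ⟩
    + 8 ∎

  -- Condition (CC) enters here, as YYᵀ = 5J + 4I: the value is 4 * 9 + 2y - (5 * 6 + 4y), where y
  -- is `Y j t`.
  Y-G : ∀ t j → ∑[ u < v ] (Y j u * G t u) ≡ + 6 - + 2 * Y j t
  Y-G t j = begin
    ∑[ u < v ] (Y j u * G t u)
      ≡⟨ sum-cong-≗ (λ u → *-comm (Y j u) (G t u)) ⟩
    ∑[ u < v ] (G t u * Y j u)
      ≡⟨ G-act t (Y j) ⟩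
    + 4 * sum (Y j) + + 2 * Y j t - ∑[ j′ < c ] (Y j′ t * ∑[ u < v ] (Y j′ u * Y j u))
      ≡⟨ cong₂ (λ a b → + 4 * a + + 2 * Y j t - b) (column-size j) meets ⟩
    + 36 + + 2 * Y j t - (+ 30 + + 4 * Y j t)
      ≡⟨ collect (Y j t) ⟩
    + 6 - + 2 * Y j t ∎
    where
    expand : ∀ y d → y * (+ 5 + + 4 * d) ≡ y * + 5 + + 4 * (d * y)
    expand = solve-∀
    collect : ∀ y → + 36 + + 2 * y - (+ 30 + + 4 * y) ≡ + 6 - + 2 * y
    collect = solve-∀
    meets : ∑[ j′ < c ] (Y j′ t * ∑[ u < v ] (Y j′ u * Y j u)) ≡ + 30 + + 4 * Y j t
    meets = begin
      ∑[ j′ < c ] (Y j′ t * ∑[ u < v ] (Y j′ u * Y j u))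
        ≡⟨ sum-cong-≗ (λ j′ → trans
             (cong (Y j′ t *_) (trans (column-meet′ j′ j) (cong (λ d → + 5 + + 4 * d) (δ-sym j′ j))))
             (expand (Y j′ t) (δ j j′))) ⟩
      ∑[ j′ < c ] (Y j′ t * + 5 + + 4 * (δ j j′ * Y j′ t))
        ≡⟨ ∑-distrib-+ (λ j′ → Y j′ t * + 5) _ ⟩
      ∑[ j′ < c ] (Y j′ t * + 5) + ∑[ j′ < c ] (+ 4 * (δ j j′ * Y j′ t))
        ≡⟨ cong₂ _+_ (Y*const t (+ 5))
             (trans (sym (*-distribˡ-sum (+ 4) (λ j′ → δ j j′ * Y j′ t)))
                    (cong (+ 4 *_) (∑-δ* j (λ j′ → Y j′ t)))) ⟩
      + 30 + + 4 * Y j t ∎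

  -- Applying `G` to its own rows gives 32J + 2G - (36J - 2YᵀY), and 2G + 2YᵀY = 8J + 4I by the
  -- definition of `G`.
  G² : ∀ s t → ∑[ u < v ] (G s u * G t u) ≡ + 4 + + 4 * δ s t
  G² s t = begin
    ∑[ u < v ] (G s u * G t u)
      ≡⟨ G-act s (G t) ⟩
    + 4 * sum (G t) + + 2 * G t s - ∑[ j < c ] (Y j s * ∑[ u < v ] (Y j u * G t u))
      ≡⟨ cong₂ (λ a b → + 4 * a + + 2 * b - ∑[ j < c ] (Y j s * ∑[ u < v ] (Y j u * G t u)))
               (G-degree t) (G-sym t s) ⟩
    + 32 + + 2 * G s t - ∑[ j < c ] (Y j s * ∑[ u < v ] (Y j u * G t u))
      ≡⟨ cong (λ a → + 32 + + 2 * G s t - a) rest ⟩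
    + 32 + + 2 * G s t - (+ 36 - + 2 * ∑[ j < c ] (Y j s * Y j t))
      ≡⟨ collect (δ s t) (∑[ j < c ] (Y j s * Y j t)) ⟩
    + 4 + + 4 * δ s t ∎
    where
    expand : ∀ x y → x * (+ 6 - + 2 * y) ≡ x * + 6 - + 2 * (x * y)
    expand = solve-∀
    collect : ∀ d b → + 32 + + 2 * (+ 4 + + 2 * d - b) - (+ 36 - + 2 * b) ≡ + 4 + + 4 * d
    collect = solve-∀
    rest : ∑[ j < c ] (Y j s * ∑[ u < v ] (Y j u * G t u)) ≡ + 36 - + 2 * ∑[ j < c ] (Y j s * Y j t)
    rest = begin
      ∑[ j < c ] (Y j s * ∑[ u < v ] (Y j u * G t u))
        ≡⟨ sum-cong-≗ (λ j → trans (cong (Y j s *_) (Y-G t j)) (expand (Y j s) (Y j t))) ⟩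
      ∑[ j < c ] (Y j s * + 6 - + 2 * (Y j s * Y j t))
        ≡⟨ ∑-distrib-- (λ j → Y j s * + 6) _ ⟩
      ∑[ j < c ] (Y j s * + 6) - ∑[ j < c ] (+ 2 * (Y j s * Y j t))
        ≡⟨ cong₂ _-_ (Y*const s (+ 6)) (sym (*-distribˡ-sum (+ 2) (λ j → Y j s * Y j t))) ⟩
      + 36 - + 2 * ∑[ j < c ] (Y j s * Y j t) ∎

  -- Both ∑ₜ Gₛₜ and ∑ₜ Gₛₜ² equal 8, and g² − g ≥ 0 for every integer g.
  G-bit : ∀ s t → Bit (G s t)
  G-bit s t = root (G s t) (∑≡0⇒≗0 (λ t → nonneg (G s t)) total t)
    where
    nonneg : ∀ g → 0ℤ ≤ g * g - g
    nonneg (+ zero)  = ≤-refl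
    nonneg +[1+ k ]  = i≤j⇒0≤j-i (+≤+ (s≤s (ℕ.m≤m+n k _)))
    nonneg -[1+ k ]  = +≤+ z≤n
    root : ∀ g → g * g - g ≡ 0ℤ → Bit g
    root (+ zero)        _  = inj₁ refl
    root (+ suc k) g²-g≡0 =
      inj₂ (*-cancelˡ-≡ (+ suc k) (+ suc k) 1ℤ
        (trans (i-j≡0⇒i≡j (+ suc k * + suc k) (+ suc k) g²-g≡0) (sym (*-identityʳ (+ suc k)))))
    total : ∑[ t < v ] (G s t * G s t - G s t) ≡ 0ℤ
    total = begin
      ∑[ t < v ] (G s t * G s t - G s t)
        ≡⟨ ∑-distrib-- (λ t → G s t * G s t) (G s) ⟩
      ∑[ t < v ] (G s t * G s t) - sum (G s)
        ≡⟨ cong₂ _-_ (trans (G² s s) (cong (λ d → + 4 + + 4 * d) (δ-refl s))) (G-degree s) ⟩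
      0ℤ ∎

  open Graph v≡15 G G-bit G-irrefl G-sym G² using (Clique; meet≡1or5)

  -- Complements of rows

  missing : Fin r → Fin v → ℤ
  missing i s = 1ℤ - X i s

  missing-size : ∀ i → sum (missing i) ≡ + 5
  missing-size i = trans (∑-distrib-- (λ _ → 1ℤ) (X i)) (cong₂ _-_ order (row-size i))

  -- Condition (RC) enters here: a column has 9 - 6 = 3 symbols missing from the row, so `G-act`
  -- gives 4 * 5 + 2m - 6 * 3, where m is `missing i s`.
  missing-clique : ∀ i → Clique (missing i)
  missing-clique i = record
    { bit    = λ s → bit-complement (X-bit i s)
    ; size   = missing-size i
    ; degree = λ s → begin
        ∑[ t < v ] (G s t * missing i t)
          ≡⟨ G-act s (missing i) ⟩
        + 4 * sum (missing i) + + 2 * missing i s - ∑[ j < c ] (Y j s * ∑[ t < v ] (Y j t * missing i t))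
          ≡⟨ cong₂ (λ a b → + 4 * a + + 2 * missing i s - b) (missing-size i)
               (trans (sum-cong-≗ λ j → cong (Y j s *_) (column-missing j)) (Y*const s (+ 3))) ⟩
        + 20 + + 2 * missing i s - + 18
          ≡⟨ collect (missing i s) ⟩
        + 2 + + 2 * missing i s ∎
    }
    where
    expand : ∀ x y → y * (1ℤ - x) ≡ y - x * y
    expand = solve-∀
    collect : ∀ x → + 20 + + 2 * x - + 18 ≡ + 2 + + 2 * x
    collect = solve-∀
    column-missing : ∀ j → ∑[ t < v ] (Y j t * missing i t) ≡ + 3
    column-missing j = begin
      ∑[ t < v ] (Y j t * missing i t)
        ≡⟨ sum-cong-≗ (λ t → expand (X i t) (Y j t)) ⟩
      ∑[ t < v ] (Y j t - X i t * Y j t)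
        ≡⟨ ∑-distrib-- (Y j) _ ⟩
      sum (Y j) - ∑[ t < v ] (X i t * Y j t)
        ≡⟨ cong₂ _-_ (column-size j) (trans (rc i j) λrc≡6) ⟩
      + 3 ∎

  missing-replication : ∀ s → ∑[ i < r ] missing i s ≡ + 3
  missing-replication s = begin
    ∑[ i < r ] (1ℤ - X i s)                ≡⟨ ∑-distrib-- (λ _ → 1ℤ) (λ i → X i s) ⟩
    ∑[ i < r ] 1ℤ - ∑[ i < r ] X i s       ≡⟨ cong₂ _-_ (trans (∑-one r) (cong +_ r≡9))
                                                        (row-replication s) ⟩
    + 3                                    ∎

  -- The two evaluations of the same sum give 15 = 9 + 4 * `sum e`, so 4 would divide 6. Absolute
  -- values carry this to the natural numbers, where divisibility is decided.
  contradiction : ⊥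
  contradiction = from-no (4 ℕ.∣? 6) (ℕ.divides ℤ.∣ sum e ∣ (begin
    6                          ≡⟨ cong ℤ.∣_∣ 4∑e≡6 ⟨
    ℤ.∣ + 4 * sum e ∣          ≡⟨ abs-* (+ 4) (sum e) ⟩
    4 ℕ.* ℤ.∣ sum e ∣          ≡⟨ ℕ.*-comm 4 ℤ.∣ sum e ∣ ⟩
    ℤ.∣ sum e ∣ ℕ.* 4          ∎))
    where
    i₀ : Fin r
    i₀ = subst Fin (sym r≡9) zero
    e : Fin r → ℤ
    e i = meet≡1or5 (missing-clique i₀) (missing-clique i) .proj₁
    flags : ∑[ i < r ] ∑[ s < v ] (missing i₀ s * missing i s) ≡ + 15
    flags = begin
      ∑[ i < r ] ∑[ s < v ] (missing i₀ s * missing i s)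
        ≡⟨ ∑-comm (λ i s → missing i₀ s * missing i s) ⟩
      ∑[ s < v ] ∑[ i < r ] (missing i₀ s * missing i s)
        ≡⟨ sum-cong-≗ (λ s → trans (sym (*-distribˡ-sum (missing i₀ s) (λ i → missing i s)))
                                   (cong (missing i₀ s *_) (missing-replication s))) ⟩
      ∑[ s < v ] (missing i₀ s * + 3)
        ≡⟨ *-distribʳ-sum (+ 3) (missing i₀) ⟨
      sum (missing i₀) * + 3
        ≡⟨ cong (_* + 3) (missing-size i₀) ⟩
      + 15 ∎
    flags′ : ∑[ i < r ] ∑[ s < v ] (missing i₀ s * missing i s) ≡ + 9 + + 4 * sum e
    flags′ = begin
      ∑[ i < r ] ∑[ s < v ] (missing i₀ s * missing i s)
        ≡⟨ sum-cong-≗ (λ i → meet≡1or5 (missing-clique i₀) (missing-clique i) .proj₂) ⟩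
      ∑[ i < r ] (1ℤ + + 4 * e i)
        ≡⟨ ∑-distrib-+ {r} (λ _ → 1ℤ) (λ i → + 4 * e i) ⟩
      ∑[ i < r ] 1ℤ + ∑[ i < r ] (+ 4 * e i)
        ≡⟨ cong₂ _+_ (trans (∑-one r) (cong +_ r≡9)) (sym (*-distribˡ-sum (+ 4) e)) ⟩
      + 9 + + 4 * sum e ∎
    4∑e≡6 : + 4 * sum e ≡ + 6
    4∑e≡6 = trans (collect (+ 4 * sum e)) (cong (_- + 9) (trans (sym flags′) flags))
      where
      collect : ∀ a → a ≡ + 9 + a - + 9
      collect = solve-∀
-- From designs to their incidence functions

⟦_⟧ : Bool → ℤ
⟦ b ⟧ = if b then 1ℤ else 0ℤ

bit-⟦_⟧ : ∀ b → Bit ⟦ b ⟧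
bit-⟦ false ⟧ = inj₁ refl
bit-⟦ true  ⟧ = inj₂ refl

⟦∨⟧ : ∀ a b → ⟦ a ⟧ * ⟦ b ⟧ ≡ 0ℤ → ⟦ a ∨ b ⟧ ≡ ⟦ a ⟧ + ⟦ b ⟧
⟦∨⟧ false false _ = refl
⟦∨⟧ false true  _ = refl
⟦∨⟧ true  false _ = refl

⟦does-≟⟧ : (s t : Fin n) → ⟦ does (s ≟ t) ⟧ ≡ δ s t
⟦does-≟⟧ s t with s ≟ t
... | yes refl = sym (δ-refl s)
... | no  s≢t  = sym (δ-≢ s≢t)

δ-*-≢ : {a b : Fin n} (s : Fin n) → a ≢ b → δ a s * δ b s ≡ 0ℤ
δ-*-≢ {a = a} {b} s a≢b with a ≟ s
... | no a≢s rewrite δ-≢ a≢s = refl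
... | yes refl rewrite δ-≢ (a≢b ∘ sym) = *-zeroʳ (δ a a)

χ : Subset n → Fin n → ℤ
χ p s = ⟦ lookup p s ⟧

χ-⁅⁆ : (a s : Fin n) → χ ⁅ a ⁆ s ≡ δ a s
χ-⁅⁆ zero    zero    = refl
χ-⁅⁆ zero    (suc s) = cong ⟦_⟧ (lookup-replicate s false)
χ-⁅⁆ (suc a) zero    = refl
χ-⁅⁆ (suc a) (suc s) = χ-⁅⁆ a s

∣∩∣ : (p q : Subset n) → + ∣ p ∩ q ∣ ≡ ∑[ s < n ] (χ p s * χ q s)
∣∩∣ []          []          = refl
∣∩∣ (true  ∷ p) (true  ∷ q) = cong (_+_ 1ℤ) (∣∩∣ p q)
∣∩∣ (true  ∷ p) (false ∷ q) = trans (∣∩∣ p q) (sym (+-identityˡ _))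
∣∩∣ (false ∷ p) (b     ∷ q) = trans (∣∩∣ p q) (sym (+-identityˡ _))

-- Injectivity makes the singletons disjoint, so no symbol is counted twice and the indicator of the
-- union is additive.
χ-⋃ : {f : Fin m → Fin n} → Injective _≡_ _≡_ f → ∀ s →
      χ (⋃ (List.tabulate (λ j → ⁅ f j ⁆))) s ≡ ∑[ j < m ] δ (f j) s
χ-⋃ {zero}      f-inj s = cong ⟦_⟧ (lookup-replicate s false)
χ-⋃ {suc m} {f = f} f-inj s = begin
  χ (⁅ f zero ⁆ ∪ tail) s        ≡⟨ cong ⟦_⟧ (lookup-zipWith _∨_ s ⁅ f zero ⁆ tail) ⟩
  ⟦ lookup ⁅ f zero ⁆ s ∨ lookup tail s ⟧ ≡⟨ ⟦∨⟧ (lookup ⁅ f zero ⁆ s) (lookup tail s) exclusive ⟩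
  χ ⁅ f zero ⁆ s + χ tail s             ≡⟨ cong₂ _+_ (χ-⁅⁆ (f zero) s) tail-χ ⟩
  δ (f zero) s + ∑[ j < m ] δ (f (suc j)) s ∎
  where
  open ≡-Reasoning
  tail = ⋃ (List.tabulate (λ j → ⁅ f (suc j) ⁆))
  tail-χ : χ tail s ≡ ∑[ j < m ] δ (f (suc j)) s
  tail-χ = χ-⋃ (λ eq → suc-injective (f-inj eq)) s
  0≢suc : ∀ j → f zero ≢ f (suc j)
  0≢suc j eq with f-inj eq
  ... | ()
  exclusive : χ ⁅ f zero ⁆ s * χ tail s ≡ 0ℤ
  exclusive = trans (cong₂ _*_ (χ-⁅⁆ (f zero) s) tail-χ)
    (trans (*-distribˡ-sum (δ (f zero) s) (λ j → δ (f (suc j)) s)) (∑-zero λ j → δ-*-≢ s (0≢suc j)))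

-- Counting occurrences by double sums

module _ {A : Set} {P : Pred A 0ℓ} (P? : Decidable P) where

  length-filter-tabulate : (f : Fin n → A) →
    + length (filter P? (List.tabulate f)) ≡ ∑[ k < n ] ⟦ does (P? (f k)) ⟧
  length-filter-tabulate {zero}  f = refl
  length-filter-tabulate {suc n} f with does (P? (f zero))
  ... | true  = cong (_+_ 1ℤ) (length-filter-tabulate (f ∘ suc))
  ... | false = trans (length-filter-tabulate (f ∘ suc)) (sym (+-identityˡ _))

-- Arbitrary tabulations let the induction pass from `f` to `f ∘ suc`; the cells of an array are the
-- case where both functions are `id`.
length-filter-product : ∀ {A B : Set} {P : Pred (A × B) 0ℓ} (P? : Decidable P)
  (f : Fin m → A) (g : Fin n → B) →
  + length (filter P? (cartesianProduct (List.tabulate f) (List.tabulate g))) ≡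
  ∑[ i < m ] ∑[ j < n ] ⟦ does (P? (f i , g j)) ⟧
length-filter-product {zero}  P? f g = refl
length-filter-product {suc m} P? f g = begin
  + length (filter P? (first List.++ rest))
    ≡⟨ cong (λ xs → + length xs) (filter-++ P? first rest) ⟩
  + length (filter P? first List.++ filter P? rest)
    ≡⟨ cong +_ (length-++ (filter P? first)) ⟩
  + length (filter P? first) + + length (filter P? rest)
    ≡⟨ cong₂ _+_ (trans (cong (λ xs → + length (filter P? xs)) (map-tabulate g (f zero ,_)))
                        (length-filter-tabulate P? (λ j → f zero , g j)))
                 (length-filter-product P? (f ∘ suc) g) ⟩
  _ ∎
  where
  open ≡-Reasoning
  first = List.map (f zero ,_) (List.tabulate g)
  rest  = cartesianProduct (List.tabulate (f ∘ suc)) (List.tabulate g)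

module Incidence {r c v e} (D : RowColumnDesign r c v e) where
  open RowColumnDesign D

  row-χ : ∀ i s → χ (rowSet i) s ≡ ∑[ j < c ] δ (entry i j) s
  row-χ i = χ-⋃ (row-injective i)

  column-χ : ∀ j s → χ (columnSet j) s ≡ ∑[ i < r ] δ (entry i j) s
  column-χ j = χ-⋃ (column-injective j)

  ∑-distinct : (f : Fin n → Fin v) → ∑[ s < v ] ∑[ k < n ] δ (f k) s ≡ + n
  ∑-distinct {n} f =
    trans (∑-comm (λ s k → δ (f k) s))
      (trans (sum-cong-≗ λ k → ∑-δ (f k)) (∑-one n))

  row-size : ∀ i → sum (χ (rowSet i)) ≡ + c
  row-size i = trans (sum-cong-≗ (row-χ i)) (∑-distinct (entry i))

  column-size : ∀ j → sum (χ (columnSet j)) ≡ + r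
  column-size j = trans (sum-cong-≗ (column-χ j)) (∑-distinct (λ i → entry i j))

  row-replication : ∀ s → ∑[ i < r ] χ (rowSet i) s ≡ + e
  row-replication s = begin
    ∑[ i < r ] χ (rowSet i) s
      ≡⟨ sum-cong-≗ (λ i → row-χ i s) ⟩
    ∑[ i < r ] ∑[ j < c ] δ (entry i j) s
      ≡⟨ sum-cong-≗ (λ i → sum-cong-≗ λ j → ⟦does-≟⟧ (entry i j) s) ⟨
    ∑[ i < r ] ∑[ j < c ] ⟦ does (entry i j ≟ s) ⟧
      ≡⟨ length-filter-product (λ (i , j) → entry i j ≟ s) id id ⟨
    + occurrences entry s
      ≡⟨ cong +_ (equireplicate s) ⟩
    + e ∎
    where open ≡-Reasoning

  column-replication : ∀ s → ∑[ j < c ] χ (columnSet j) s ≡ + e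
  column-replication s = begin
    ∑[ j < c ] χ (columnSet j) s           ≡⟨ sum-cong-≗ (λ j → column-χ j s) ⟩
    ∑[ j < c ] ∑[ i < r ] δ (entry i j) s  ≡⟨ ∑-comm (λ j i → δ (entry i j) s) ⟩
    ∑[ i < r ] ∑[ j < c ] δ (entry i j) s  ≡⟨ sum-cong-≗ (λ i → row-χ i s) ⟨
    ∑[ i < r ] χ (rowSet i) s              ≡⟨ row-replication s ⟩
    + e                                    ∎
    where open ≡-Reasoning

-- Nonexistence of the transposed sesqui array

no-transposed-sesqui : ∀ {r c v} → r ≡ 9 → c ≡ 10 → v ≡ 15 →
  (D : RowColumnDesign r c v 6) → ¬ TransposedSesqui D
no-transposed-sesqui r≡9 c≡10 v≡15 D ((λcc , cc) , (λrc , rc)) =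
  Counting.contradiction r≡9 c≡10 v≡15
    (λ i → χ (rowSet i)) (λ i s → bit-⟦ lookup (rowSet i) s ⟧)
    (λ i → trans (row-size i) (cong +_ c≡10)) row-replication
    (λ j → χ (columnSet j)) (λ j s → bit-⟦ lookup (columnSet j) s ⟧)
    (λ j → trans (column-size j) (cong +_ r≡9)) column-replication
    (+ λcc) (λ j j′ j≢j′ → trans (sym (∣∩∣ (columnSet j) (columnSet j′))) (cong +_ (cc j j′ j≢j′)))
    (+ λrc) (λ i j → trans (sym (∣∩∣ (rowSet i) (columnSet j))) (cong +_ (rc i j)))
  where
  open RowColumnDesign D
  open Incidence D

-- A proper AO-array

-- The symbols form three groups {0,…,4}, {5,…,9}, {10,…,14}.  The rows come in three bands
-- of three, each band omitting one group.  The columns correspond to the pairs in a 5-set,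
-- each omitting its pair from all three groups.
table : Vec (Vec (Fin 15) 10) 9
table =
  (# 8  ∷ # 13 ∷ # 9  ∷ # 6  ∷ # 14 ∷ # 12 ∷ # 7  ∷ # 11 ∷ # 5  ∷ # 10 ∷ []) ∷
  (# 7  ∷ # 14 ∷ # 12 ∷ # 8  ∷ # 13 ∷ # 9  ∷ # 5  ∷ # 10 ∷ # 6  ∷ # 11 ∷ []) ∷
  (# 9  ∷ # 6  ∷ # 11 ∷ # 7  ∷ # 5  ∷ # 10 ∷ # 8  ∷ # 14 ∷ # 13 ∷ # 12 ∷ []) ∷
  (# 13 ∷ # 11 ∷ # 2  ∷ # 12 ∷ # 4  ∷ # 14 ∷ # 10 ∷ # 1  ∷ # 3  ∷ # 0  ∷ []) ∷
  (# 12 ∷ # 4  ∷ # 14 ∷ # 11 ∷ # 3  ∷ # 2  ∷ # 13 ∷ # 0  ∷ # 10 ∷ # 1  ∷ []) ∷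
  (# 14 ∷ # 3  ∷ # 1  ∷ # 13 ∷ # 10 ∷ # 0  ∷ # 12 ∷ # 4  ∷ # 11 ∷ # 2  ∷ []) ∷
  (# 3  ∷ # 8  ∷ # 4  ∷ # 1  ∷ # 9  ∷ # 7  ∷ # 2  ∷ # 6  ∷ # 0  ∷ # 5  ∷ []) ∷
  (# 2  ∷ # 9  ∷ # 7  ∷ # 3  ∷ # 8  ∷ # 4  ∷ # 0  ∷ # 5  ∷ # 1  ∷ # 6  ∷ []) ∷
  (# 4  ∷ # 1  ∷ # 6  ∷ # 2  ∷ # 0  ∷ # 5  ∷ # 3  ∷ # 9  ∷ # 8  ∷ # 7  ∷ []) ∷ []

injective? : (f : Fin m → Fin n) → Dec (∀ i j → f i ≡ f j → i ≡ j)
injective? f = all? λ i → all? λ j → (f i ≟ f j) →-dec (i ≟ j)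

array : RowColumnDesign 9 10 15 6
array = record
  { entry            = A
  ; row-injective    = λ i eq → from-yes (all? λ i → injective? (A i)) i _ _ eq
  ; column-injective = λ j eq → from-yes (all? λ j → injective? (λ i → A i j)) j _ _ eq
  ; equireplicate    = from-yes (all? λ s → occurrences A s ℕ.≟ 6)
  }
  where
  A : Fin 9 → Fin 10 → Fin 15
  A i j = lookup (lookup table i) j

array-proper : ProperAO array
array-proper = rc , ¬rr , ¬cc
  where
  open RowColumnDesign array
  rc : RC array
  -- A row consists of two full groups, and a column has three symbols in each group.
  rc = 6 , from-yes (all? λ i → all? λ j → ∣ rowSet i ∩ columnSet j ∣ ℕ.≟ 6)
  ¬rr : ¬ RR array
  -- Rows 0 and 1 lie in one band and share all 10 symbols; row 3 lies in another band and shares 5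
  -- with row 0.
  ¬rr (_ , rr) with trans (rr 0F 1F (λ ())) (sym (rr 0F 3F (λ ())))
  ... | ()
  ¬cc : ¬ CC array
  -- Modulo 5, columns 0, 1 and 7 omit the pairs {0,1}, {0,2} and {2,3}. The first two pairs
  -- overlap, which leaves 6 common symbols; the first and third are disjoint, which leaves 3.
  ¬cc (_ , cc) with trans (cc 0F 1F (λ ())) (sym (cc 0F 7F (λ ())))
  ... | ()

mainTheorem6 : (¬ (Σ[ D ∈ RowColumnDesign 9 10 15 6 ] TransposedSesqui D)) × (Σ[ D ∈ RowColumnDesign 9 10 15 6 ] ProperAO D)
mainTheorem6 = (λ (D , sesqui) → no-transposed-sesqui refl refl refl D sesqui) , array , array-proper
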